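{- For every nonnegative integer $n$, $$q_{odd}'''(n)=\sum_{j=-\infty}^{\infty}pod(n-j^2).$$
   Context: $pod(n)$ denotes the number of partitions of $n$ in which odd parts are distinct and even parts may be repeated, with $pod(0)=1$ and $pod(m)=0$ for $m<0$. $q_{odd}'''(n)$ denotes the number of partitions of $n$ into distinct odd parts in $3$ colors (each odd number is available in three colors, and each colored odd number is used at most once), so that $\sum_{n\ge0}q_{odd}'''(n)q^n=\prod_{k\ge0}(1+q^{2k+1})^3$; for example $q_{odd}'''(4)=9$. -}

module Defs where

open import Data.Fin as Fin using (Fin)
import Data.Fin.Properties as Fin
import Data.Integer.Properties as ℤ
open import Data.Integer using (ℤ; +_; -[1+_])
open import Data.List using
  (List; []; _∷_; map; filter; length; upTo; allFin; cartesianProduct; cartesianProductWith)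
open import Data.List.Membership.DecPropositional ℤ._≟_ using (_∈?_)
open import Data.List.Membership.Propositional using (_∈_; _∉_)
open import Data.List.Membership.Propositional.Properties using
  ( ∈-cartesianProductWith⁺; ∈-cartesianProductWith⁻; ∈-cartesianProduct⁺
  ; ∈-map⁺; ∈-upTo⁺; ∈-allFin; ∈-filter⁺; ∈-filter⁻)
open import Data.List.Properties using (∷-injective; filter-accept; filter-reject; map-id)
open import Data.List.Relation.Binary.BagAndSetEquality using (∼bag⇒↭)
open import Data.List.Membership.Propositional.Properties.WithK using (unique∧set⇒bag)
open import Data.List.Relation.Binary.Permutation.Propositional.Properties using (map⁺)
open import Data.List.Relation.Unary.All as All using (All; []; _∷_)
open import Data.List.Relation.Unary.AllPairs using ([]; _∷_)
open import Data.List.Relation.Unary.Any using (here; there)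
open import Data.List.Relation.Unary.Linked using (Linked; linked?)
open import Data.List.Relation.Unary.Unique.Propositional using (Unique)
import Data.List.Relation.Unary.Unique.Propositional.Properties as Unique
open import Data.List.Relation.Unary.Unique.DecPropositional using (unique?)
open import Data.Nat using (ℕ; zero; suc; _+_; _≤_; _<_; _≥_; _>_; z≤n; s≤s; _≟_; _≥?_; _>?_; _<?_)
open import Data.Nat.Divisibility using (_∣_; _∣?_; _∣0)
open import Data.Nat.ListAction using (sum)
open import Data.Nat.ListAction.Properties using (sum-↭)
open import Data.Nat.Properties using (suc-injective; m≤m+n; m≤n+m; ≤-trans; ≤-reflexive; +-mono-≤)
open import Data.Product using (_×_; _,_; proj₁; proj₂; ∃-syntax)
open import Data.Product.Relation.Binary.Lex.Strict using (×-Lex; ×-decidable)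
open import Function using (_∘_; _⇔_; mk⇔; case_of_)
open import Relation.Binary as Binary using (Rel)
open import Relation.Binary.PropositionalEquality using (_≡_; refl; sym; trans; cong; cong₂)
open import Relation.Nullary using (¬_; yes; no; contradiction)
open import Relation.Nullary.Decidable using (¬?; _×-dec_)
open import Relation.Unary using (Pred; Decidable)

private
  variable
    A : Set

Odd : Pred ℕ _
Odd k = ¬ (2 ∣ k)

odd? : Decidable Odd
odd? k = ¬? (2 ∣? k)

IsPartition : ℕ → Pred (List ℕ) _
IsPartition n xs = Linked _≥_ xs × All (0 <_) xs × sum xs ≡ n

IsPodPartition : ℕ → Pred (List ℕ) _
IsPodPartition n xs = IsPartition n xs × Unique (filter odd? xs)

isPodPartition? : ∀ n → Decidable (IsPodPartition n)
isPodPartition? n xs =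
  (linked? _≥?_ xs ×-dec All.all? (0 <?_) xs ×-dec sum xs ≟ n)
  ×-dec unique? _≟_ (filter odd? xs)

ColouredPart : Set
ColouredPart = ℕ × Fin 3

_≻_ : Rel ColouredPart _
_≻_ = ×-Lex _≡_ _>_ (Fin._>_ {3} {3})

_≻?_ : Binary.Decidable _≻_
_≻?_ = ×-decidable _≟_ _>?_ (λ c d → d Fin.<? c)

-- The order ≻ (by size, then by colour) is strict, so no coloured part is
-- repeated, while the same size may still occur in different colours.
IsOddTricolouredPartition : ℕ → Pred (List ColouredPart) _
IsOddTricolouredPartition n ps =
  Linked _≻_ ps × All (Odd ∘ proj₁) ps × sum (map proj₁ ps) ≡ n

isOddTricolouredPartition? : ∀ n → Decidable (IsOddTricolouredPartition n)
isOddTricolouredPartition? n ps =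
  linked? _≻?_ ps ×-dec All.all? (odd? ∘ proj₁) ps ×-dec sum (map proj₁ ps) ≟ n

-- All lists of length at most b with entries in as.
words : List A → ℕ → List (List A)
words as zero    = [] ∷ []
words as (suc b) = [] ∷ cartesianProductWith _∷_ as (words as b)

-- A partition of n has at most n parts, each at most n, so searching the
-- following finite lists misses nothing; see the ∈-… and …-unique lemmas below.
sizes : ℕ → List ℕ
sizes n = map suc (upTo n)

podPartitions : ℕ → List (List ℕ)
podPartitions n = filter (isPodPartition? n) (words (sizes n) n)

oddTricolouredPartitions : ℕ → List (List ColouredPart)
oddTricolouredPartitions n =
  filter (isOddTricolouredPartition? n) (words (cartesianProduct (sizes n) (allFin 3)) n)

pod : ℤ → ℕ
pod (+ n)    = length (podPartitions n)
pod -[1+ _ ] = 0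

qodd''' : ℕ → ℕ
qodd''' n = length (oddTricolouredPartitions n)

-- The sum of f over all of ℤ, for f of finite support: js is any finite set of
-- indices outside of which f vanishes; s is independent of the choice
-- (HasSum-unique).
_HasSum_ : (ℤ → ℕ) → ℕ → Set
f HasSum s =
  ∃[ js ] Unique js × (∀ j → j ∉ js → f j ≡ 0) × sum (map f js) ≡ s

words-unique : ∀ {as : List A} → Unique as → ∀ b → Unique (words as b)
words-unique u zero    = [] ∷ []
words-unique {as = as} u (suc b) =
  All.tabulate (λ { xs∈ refl → nonEmpty xs∈ })
  ∷ Unique.cartesianProductWith⁺ _∷_ ∷-injective u (words-unique u b)
  where
  nonEmpty : [] ∉ cartesianProductWith _∷_ as (words as b)
  nonEmpty p with _ , _ , _ , _ , () ← ∈-cartesianProductWith⁻ _∷_ as (words as b) p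

∈-words : ∀ {as : List A} {b xs} → length xs ≤ b → All (_∈ as) xs → xs ∈ words as b
∈-words {b = zero}  {[]} _ _ = here refl
∈-words {b = suc b} {[]} _ _ = here refl
∈-words {b = suc b} {x ∷ xs} (s≤s l) (x∈ ∷ xs∈) =
  there (∈-cartesianProductWith⁺ _∷_ x∈ (∈-words l xs∈))

sizes-unique : ∀ n → Unique (sizes n)
sizes-unique n = Unique.map⁺ suc-injective (Unique.upTo⁺ n)

∈-sizes : ∀ {k n} → 0 < k → k ≤ n → k ∈ sizes n
∈-sizes {suc k} _ k<n = ∈-map⁺ suc (∈-upTo⁺ k<n)

module _ (size : A → ℕ) where

  length≤total : ∀ {xs} → All ((0 <_) ∘ size) xs → length xs ≤ sum (map size xs)
  length≤total []         = z≤n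
  length≤total (px ∷ pxs) = +-mono-≤ px (length≤total pxs)

  size≤total : ∀ xs → All (λ x → size x ≤ sum (map size xs)) xs
  size≤total []       = []
  size≤total (x ∷ xs) =
    m≤m+n _ _ ∷ All.map (λ l → ≤-trans l (m≤n+m _ (size x))) (size≤total xs)

odd⇒positive : ∀ {k} → Odd k → 0 < k
odd⇒positive {zero}  o = contradiction (2 ∣0) o
odd⇒positive {suc k} _ = s≤s z≤n

∈-podPartitions : ∀ n xs → xs ∈ podPartitions n ⇔ IsPodPartition n xs
∈-podPartitions n xs =
  mk⇔ (proj₂ ∘ ∈-filter⁻ (isPodPartition? n) {xs = words (sizes n) n}) complete
  where
  complete : IsPodPartition n xs → xs ∈ podPartitions n
  complete p@((_ , pos , sum≡n) , _) = ∈-filter⁺ (isPodPartition? n)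
    (∈-words (≤-trans (length≤total (λ k → k) pos) (≤-reflexive total≡n))
             (All.zipWith (λ { (0<k , k≤) → ∈-sizes 0<k (≤-trans k≤ (≤-reflexive total≡n)) })
                          (pos , size≤total (λ k → k) xs)))
    p
    where
    total≡n : sum (map (λ k → k) xs) ≡ n
    total≡n = trans (cong sum (map-id xs)) sum≡n

podPartitions-unique : ∀ n → Unique (podPartitions n)
podPartitions-unique n =
  Unique.filter⁺ (isPodPartition? n) (words-unique (sizes-unique n) n)

∈-oddTricolouredPartitions :
  ∀ n ps → ps ∈ oddTricolouredPartitions n ⇔ IsOddTricolouredPartition n ps
∈-oddTricolouredPartitions n ps =
  mk⇔ (proj₂ ∘ ∈-filter⁻ (isOddTricolouredPartition? n)
                 {xs = words (cartesianProduct (sizes n) (allFin 3)) n})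
      complete
  where
  complete : IsOddTricolouredPartition n ps → ps ∈ oddTricolouredPartitions n
  complete p@(_ , odds , sum≡n) = ∈-filter⁺ (isOddTricolouredPartition? n)
    (∈-words (≤-trans (length≤total proj₁ pos) (≤-reflexive sum≡n))
             (All.zipWith (λ { (0<k , k≤) → ∈-cartesianProduct⁺
                                 (∈-sizes 0<k (≤-trans k≤ (≤-reflexive sum≡n))) (∈-allFin _) })
                          (pos , size≤total proj₁ ps)))
    p
    where
    pos : All ((0 <_) ∘ proj₁) ps
    pos = All.map odd⇒positive odds

oddTricolouredPartitions-unique : ∀ n → Unique (oddTricolouredPartitions n)
oddTricolouredPartitions-unique n = Unique.filter⁺ (isOddTricolouredPartition? n)
  (words-unique (Unique.cartesianProduct⁺ (sizes-unique n) (Unique.allFin⁺ 3)) n)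

HasSum-unique : ∀ {f s t} → f HasSum s → f HasSum t → s ≡ t
HasSum-unique {f} (is , uᵢ , zᵢ , refl) (js , uⱼ , zⱼ , refl) =
  trans (sum-support is) (trans (sum-↭ (map⁺ f (∼bag⇒↭ supports)))
                                (sym (sum-support js)))
  where
  nonzero? : Decidable (λ j → ¬ f j ≡ 0)
  nonzero? j = ¬? (f j ≟ 0)

  sum-support : ∀ ks → sum (map f ks) ≡ sum (map f (filter nonzero? ks))
  sum-support []       = refl
  sum-support (k ∷ ks) = case f k ≟ 0 of λ where
    (yes fk≡0) → trans (cong₂ _+_ fk≡0 (sum-support ks))
      (cong (sum ∘ map f) (sym (filter-reject nonzero? (λ fk≢0 → fk≢0 fk≡0))))
    (no fk≢0)  → trans (cong₂ _+_ refl (sum-support ks))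
      (cong (sum ∘ map f) (sym (filter-accept nonzero? fk≢0)))

  transfer : ∀ {ks ls} → (∀ j → j ∉ ls → f j ≡ 0) →
             ∀ {j} → j ∈ filter nonzero? ks → j ∈ filter nonzero? ls
  transfer {ks} {ls} z {j} j∈ with ∈-filter⁻ nonzero? {xs = ks} j∈ | j ∈? ls
  ... | _ , fj≢0 | yes j∈ls = ∈-filter⁺ nonzero? j∈ls fj≢0
  ... | _ , fj≢0 | no  j∉ls = contradiction (z j j∉ls) fj≢0

  supports = unique∧set⇒bag
    (Unique.filter⁺ nonzero? uᵢ) (Unique.filter⁺ nonzero? uⱼ)
    (mk⇔ (transfer {is} zⱼ) (transfer {js} zᵢ))

{-# OPTIONS --safe #-}

-- Write P_m for multiplication by (1 + q)(1 + q³) ⋯ (1 + q^(2m−1)) and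
-- [a+b, a] for the Gaussian binomial coefficient in q².  The finite form of
-- Jacobi's triple product at z = 1,
--   P_r P_s 1 = Σ_j q^(j²) [r+s, s+j],
-- follows from q-Pascal, one factor at a time.  Applying P_n to the case
-- r = s = n gives P_n³ 1 = Σ_j q^(j²) P_n [2n, n+j].  On the left, the
-- coefficient of qⁿ is qodd''' n.  On the right, P_a [a+b, a] counts pod
-- partitions with parts at most 2a and at most b even parts, and in degree
-- n − j² these bounds (even with P_n in place of P_a) do not bite, because
-- n − j² ≤ n − |j| = min(a, b) for a = n − j, b = n + j.
module Submission where

open import Defs
open import Data.Fin as Fin using (Fin; zero; suc)
import Data.Fin.Properties as Fin
open import Data.List using (List; []; _∷_; _++_; map; filter; length; downFrom)
open import Data.List.Membership.Propositional using (_∈_; _∉_)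
open import Data.List.Membership.Propositional.Properties
  using (∈-++⁺ˡ; ∈-++⁺ʳ; ∈-++⁻; ∈-map⁺; ∈-map⁻; ∈-filter⁺; ∈-downFrom⁺)
open import Data.List.Membership.Propositional.Properties.WithK using (unique∧set⇒bag)
open import Data.List.Properties
  using (length-++; length-map; map-id; map-∘; ∷-injectiveʳ; filter-accept; filter-reject)
open import Data.List.Relation.Binary.BagAndSetEquality using (∼bag⇒↭)
open import Data.List.Relation.Binary.Permutation.Propositional.Properties using (↭-length)
open import Data.List.Relation.Binary.Sublist.Propositional
  using (_⊆_; []; _∷_; _∷ʳ_; minimum; lookup)
open import Data.List.Relation.Binary.Sublist.Propositional.Properties using (All-resp-⊆)
open import Data.List.Relation.Unary.All as All using (All; []; _∷_)
import Data.List.Relation.Unary.All.Properties as All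
open import Data.List.Relation.Unary.AllPairs as AllPairs using (AllPairs; []; _∷_)
open import Data.List.Relation.Unary.Any using (here; there)
open import Data.List.Relation.Unary.Linked using (Linked; []; [-]; _∷_)
open import Data.List.Relation.Unary.Linked.Properties using (AllPairs⇒Linked; Linked⇒AllPairs)
open import Data.List.Relation.Unary.Unique.Propositional using (Unique)
import Data.List.Relation.Unary.Unique.Propositional.Properties as Unique
open import Data.Nat
  using (ℕ; zero; suc; _+_; _*_; _∸_; _≤_; _<_; _≥_; _>_; z≤n; s≤s; ∣_-_∣; _≤?_)
open import Data.Nat.Divisibility using (divides; m∣m*n)
open import Data.Nat.ListAction using (sum)
open import Data.Nat.Properties
open import Data.Nat.Tactic.RingSolver using (solve-∀)
open import Data.Product using (_×_; _,_; proj₁; proj₂; ∃₂; ∃-syntax)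
open import Data.Product.Relation.Binary.Lex.Strict using (×-transitive; ×-asymmetric)
open import Data.Sum using (_⊎_; inj₁; inj₂)
open import Function using (_∘_; case_of_; flip; _⇔_; mk⇔)
open import Function.Bundles using (module Equivalence)
open import Level using (0ℓ)
open import Relation.Binary using (Rel; Transitive; Asymmetric)
open import Relation.Binary.PropositionalEquality
open import Relation.Nullary using (¬_; yes; no; contradiction)
open ≡-Reasoning

-- Power series as coefficient functions

Series : Set
Series = ℕ → ℕ

infixl 6 _⊕_
_⊕_ : Series → Series → Series
(f ⊕ g) n = f n + g n

one : Series
one zero    = 1
one (suc _) = 0

-- Multiplication by q^k, by recursion on both arguments so that no truncated subtraction of degrees
-- appears.
shift : ℕ → Series → Series
shift zero    f n       = f n
shift (suc k) f zero    = 0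
shift (suc k) f (suc n) = shift k f n

+-interchange : ∀ a b c d → (a + b) + (c + d) ≡ (a + c) + (b + d)
+-interchange = solve-∀

-- Only the degree `n - k` matters. The equation `d + k ≡ n` passed to the hypothesis lets later
-- arguments bound `d` where two series agree in low degrees only.
shift-cong-at : ∀ k n {f g} → (∀ d → d + k ≡ n → f d ≡ g d) → shift k f n ≡ shift k g n
shift-cong-at zero    n       f≡g = f≡g n (+-identityʳ n)
shift-cong-at (suc k) zero    f≡g = refl
shift-cong-at (suc k) (suc n) f≡g =
  shift-cong-at k n λ d d+k≡n → f≡g d (trans (+-suc d k) (cong suc d+k≡n))

shift-cong : ∀ k {f g} → f ≗ g → shift k f ≗ shift k g
shift-cong k f≗g n = shift-cong-at k n λ d _ → f≗g d

shift-⊕ : ∀ k f g → shift k (f ⊕ g) ≗ shift k f ⊕ shift k g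
shift-⊕ zero    f g n       = refl
shift-⊕ (suc k) f g zero    = refl
shift-⊕ (suc k) f g (suc n) = shift-⊕ k f g n

shift-shift : ∀ j k f → shift j (shift k f) ≗ shift (j + k) f
shift-shift zero    k f n       = refl
shift-shift (suc j) k f zero    = refl
shift-shift (suc j) k f (suc n) = shift-shift j k f n

shift-comm : ∀ j k f → shift j (shift k f) ≗ shift k (shift j f)
shift-comm j k f n = begin
  shift j (shift k f) n ≡⟨ shift-shift j k f n ⟩
  shift (j + k) f n     ≡⟨ cong (λ i → shift i f n) (+-comm j k) ⟩
  shift (k + j) f n     ≡⟨ shift-shift k j f n ⟨
  shift k (shift j f) n ∎

shift-small : ∀ {k n} f → n < k → shift k f n ≡ 0
shift-small {n = zero}  f (s≤s _)   = refl
shift-small {n = suc n} f (s≤s n<k) = shift-small f n<k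

-- Multiplication by products of factors 1 + q^k

times : ℕ → Series → Series
times k f = f ⊕ shift k f

times-cong : ∀ k {f g} → f ≗ g → times k f ≗ times k g
times-cong k f≗g n = cong₂ _+_ (f≗g n) (shift-cong k f≗g n)

-- The operator P_m. Being an operator on series, it is handled through linearity and commutation
-- with `shift` instead of a convolution product.
oddProduct : ℕ → Series → Series
oddProduct zero    f = f
oddProduct (suc m) f = times (suc (2 * m)) (oddProduct m f)

-- Each factor moves coefficients only to equal or higher degrees.
oddProduct-cong-below : ∀ m {f g n} → (∀ d → d ≤ n → f d ≡ g d) →
                        ∀ d → d ≤ n → oddProduct m f d ≡ oddProduct m g d
oddProduct-cong-below zero    f≡g d d≤n = f≡g d d≤n
oddProduct-cong-below (suc m) f≡g d d≤n = cong₂ _+_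
  (oddProduct-cong-below m f≡g d d≤n)
  (shift-cong-at (suc (2 * m)) d λ e e+k≡d →
    oddProduct-cong-below m f≡g e (≤-trans (≤-trans (m≤m+n e _) (≤-reflexive e+k≡d)) d≤n))

oddProduct-cong : ∀ m {f g} → f ≗ g → oddProduct m f ≗ oddProduct m g
oddProduct-cong m f≗g n = oddProduct-cong-below m (λ d _ → f≗g d) n ≤-refl

oddProduct-⊕ : ∀ m f g → oddProduct m (f ⊕ g) ≗ oddProduct m f ⊕ oddProduct m g
oddProduct-⊕ zero    f g n = refl
oddProduct-⊕ (suc m) f g n = begin
  times k (oddProduct m (f ⊕ g)) n
    ≡⟨ times-cong k (oddProduct-⊕ m f g) n ⟩
  oddProduct m f n + oddProduct m g n + shift k (oddProduct m f ⊕ oddProduct m g) n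
    ≡⟨ cong (oddProduct m f n + oddProduct m g n +_) (shift-⊕ k _ _ n) ⟩
  oddProduct m f n + oddProduct m g n + (shift k (oddProduct m f) n + shift k (oddProduct m g) n)
    ≡⟨ +-interchange (oddProduct m f n) _ _ _ ⟩
  (times k (oddProduct m f) ⊕ times k (oddProduct m g)) n ∎
  where k = suc (2 * m)

oddProduct-shift : ∀ m k f → oddProduct m (shift k f) ≗ shift k (oddProduct m f)
oddProduct-shift zero    k f n = refl
oddProduct-shift (suc m) k f n = begin
  times j (oddProduct m (shift k f)) n
    ≡⟨ times-cong j (oddProduct-shift m k f) n ⟩
  shift k (oddProduct m f) n + shift j (shift k (oddProduct m f)) n
    ≡⟨ cong (shift k (oddProduct m f) n +_) (shift-comm j k _ n) ⟩
  shift k (oddProduct m f) n + shift k (shift j (oddProduct m f)) n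
    ≡⟨ shift-⊕ k _ _ n ⟨
  shift k (times j (oddProduct m f)) n ∎
  where j = suc (2 * m)

oddProduct-times : ∀ m k f → oddProduct m (times k f) ≗ times k (oddProduct m f)
oddProduct-times m k f n =
  trans (oddProduct-⊕ m f (shift k f) n)
        (cong (oddProduct m f n +_) (oddProduct-shift m k f n))

-- Every factor added after the first `m` is 1 + q^(2i+1) with i ≥ m, so its shift starts above
-- degree `d`.
oddProduct-stable : ∀ k m f {d} → d ≤ m → oddProduct (k + m) f d ≡ oddProduct m f d
oddProduct-stable zero    m f d≤m = refl
oddProduct-stable (suc k) m f {d} d≤m = begin
  oddProduct (k + m) f d + shift (suc (2 * (k + m))) (oddProduct (k + m) f) d
    ≡⟨ cong (oddProduct (k + m) f d +_) (shift-small _ d<) ⟩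
  oddProduct (k + m) f d + 0 ≡⟨ +-identityʳ _ ⟩
  oddProduct (k + m) f d     ≡⟨ oddProduct-stable k m f d≤m ⟩
  oddProduct m f d           ∎
  where
  d< : d < suc (2 * (k + m))
  d< = s≤s (≤-trans d≤m (≤-trans (m≤n+m m k) (m≤m+n (k + m) _)))

-- Gaussian binomials: the two q-Pascal rules and stability

-- The Gaussian binomial coefficient [a + b choose a] in q².
gauss : ℕ → ℕ → Series
gauss zero    b       = one
gauss (suc a) zero    = gauss a zero
gauss (suc a) (suc b) = gauss a (suc b) ⊕ shift (2 * suc a) (gauss (suc a) b)

gauss-zeroʳ : ∀ a → gauss a 0 ≗ one
gauss-zeroʳ zero    n = refl
gauss-zeroʳ (suc a) n = gauss-zeroʳ a n

-- The q-Pascal rule dual to the defining one, with the weight on the other term. In the inductive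
-- step both summands are expanded by this rule; the two doubly shifted copies of
-- `gauss (suc a) (suc b)` then match, their exponents both being 2(a + b + 3).
gauss-pascal : ∀ a b → gauss (suc a) (suc b) ≗
               gauss (suc a) b ⊕ shift (2 * suc b) (gauss a (suc b))
gauss-pascal zero zero n = refl
gauss-pascal zero (suc b) n = begin
  one n + shift 2 (gauss 1 (suc b)) n
    ≡⟨ cong (one n +_) (shift-cong 2 (gauss-pascal zero b) n) ⟩
  one n + shift 2 (gauss 1 b ⊕ shift (2 * suc b) one) n
    ≡⟨ cong (one n +_) (shift-⊕ 2 (gauss 1 b) _ n) ⟩
  one n + (shift 2 (gauss 1 b) n + shift 2 (shift (2 * suc b) one) n)
    ≡⟨ +-assoc (one n) _ _ ⟨
  gauss 1 (suc b) n + shift 2 (shift (2 * suc b) one) n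
    ≡⟨ cong (gauss 1 (suc b) n +_) (shift-shift 2 (2 * suc b) one n) ⟩
  gauss 1 (suc b) n + shift (2 + 2 * suc b) one n
    ≡⟨ cong (λ k → gauss 1 (suc b) n + shift k one n) (*-suc 2 (suc b)) ⟨
  gauss 1 (suc b) n + shift (2 * suc (suc b)) one n ∎
gauss-pascal (suc a) zero n = begin
  gauss (suc a) 1 n + shift (2 * suc (suc a)) (gauss (suc a) 0) n
    ≡⟨ cong₂ _+_ (gauss-pascal a zero n) tail ⟩
  gauss a 0 n + shift 2 (gauss a 1) n + shift 2 (shift (2 * suc a) (gauss (suc a) 0)) n
    ≡⟨ +-assoc (gauss a 0 n) _ _ ⟩
  gauss a 0 n + (shift 2 (gauss a 1) n + shift 2 (shift (2 * suc a) (gauss (suc a) 0)) n)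
    ≡⟨ cong (gauss a 0 n +_) (shift-⊕ 2 (gauss a 1) _ n) ⟨
  gauss a 0 n + shift 2 (gauss (suc a) 1) n ∎
  where
  tail : shift (2 * suc (suc a)) (gauss (suc a) 0) n
       ≡ shift 2 (shift (2 * suc a) (gauss (suc a) 0)) n
  tail = trans (cong (λ k → shift k (gauss (suc a) 0) n) (*-suc 2 (suc a)))
               (sym (shift-shift 2 (2 * suc a) _ n))
gauss-pascal (suc a) (suc b) n = begin
  gauss (suc a) (suc (suc b)) n + shift i (gauss (suc (suc a)) (suc b)) n
    ≡⟨ cong₂ _+_ (gauss-pascal a (suc b) n)
         (trans (shift-cong i (gauss-pascal (suc a) b) n) (shift-⊕ i (gauss (suc (suc a)) b) _ n)) ⟩
  gauss (suc a) (suc b) n + shift j (gauss a (suc (suc b))) n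
    + (shift i (gauss (suc (suc a)) b) n + shift i (shift (2 * suc b) (gauss (suc a) (suc b))) n)
    ≡⟨ +-interchange (gauss (suc a) (suc b) n) _ _ _ ⟩
  gauss (suc (suc a)) (suc b) n
    + (shift j (gauss a (suc (suc b))) n + shift i (shift (2 * suc b) (gauss (suc a) (suc b))) n)
    ≡⟨ cong (λ x → gauss (suc (suc a)) (suc b) n + (shift j (gauss a (suc (suc b))) n + x)) swap ⟩
  gauss (suc (suc a)) (suc b) n
    + (shift j (gauss a (suc (suc b))) n + shift j (shift (2 * suc a) (gauss (suc a) (suc b))) n)
    ≡⟨ cong (gauss (suc (suc a)) (suc b) n +_) (shift-⊕ j (gauss a (suc (suc b))) _ n) ⟨
  gauss (suc (suc a)) (suc b) n + shift j (gauss (suc a) (suc (suc b))) n ∎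
  where
  i = 2 * suc (suc a)
  j = 2 * suc (suc b)

  exponents : ∀ a b → 2 * suc (suc a) + 2 * suc b ≡ 2 * suc (suc b) + 2 * suc a
  exponents = solve-∀

  swap : shift i (shift (2 * suc b) (gauss (suc a) (suc b))) n
       ≡ shift j (shift (2 * suc a) (gauss (suc a) (suc b))) n
  swap = begin
    shift i (shift (2 * suc b) (gauss (suc a) (suc b))) n ≡⟨ shift-shift i (2 * suc b) _ n ⟩
    shift (i + 2 * suc b) (gauss (suc a) (suc b)) n
      ≡⟨ cong (λ k → shift k (gauss (suc a) (suc b)) n) (exponents a b) ⟩
    shift (j + 2 * suc a) (gauss (suc a) (suc b)) n       ≡⟨ shift-shift j (2 * suc a) _ n ⟨
    shift j (shift (2 * suc a) (gauss (suc a) (suc b))) n ∎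

-- Raising the first argument adds only a term shifted beyond degree `d`.
gauss-stableˡ : ∀ k a b {d} → d ≤ a → gauss (k + a) b d ≡ gauss a b d
gauss-stableˡ zero    a b       d≤a = refl
gauss-stableˡ (suc k) a zero    d≤a = gauss-stableˡ k a zero d≤a
gauss-stableˡ (suc k) a (suc b) {d} d≤a = begin
  gauss (k + a) (suc b) d + shift (2 * suc (k + a)) (gauss (suc (k + a)) b) d
    ≡⟨ cong (gauss (k + a) (suc b) d +_) (shift-small _ d<) ⟩
  gauss (k + a) (suc b) d + 0 ≡⟨ +-identityʳ _ ⟩
  gauss (k + a) (suc b) d     ≡⟨ gauss-stableˡ k a (suc b) d≤a ⟩
  gauss a (suc b) d           ∎
  where
  d< : d < 2 * suc (k + a)
  d< = ≤-trans (s≤s (≤-trans d≤a (m≤n+m a k))) (m≤m+n (suc (k + a)) _)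

-- The defining recursion isolates a change of the first argument; the dual rule `gauss-pascal`
-- isolates a change of the second.
gauss-stableʳ : ∀ k a b {d} → d ≤ b → gauss a (k + b) d ≡ gauss a b d
gauss-stableʳ zero    a       b d≤b = refl
gauss-stableʳ (suc k) zero    b d≤b = refl
gauss-stableʳ (suc k) (suc a) b {d} d≤b = begin
  gauss (suc a) (suc (k + b)) d ≡⟨ gauss-pascal a (k + b) d ⟩
  gauss (suc a) (k + b) d + shift (2 * suc (k + b)) (gauss a (suc (k + b))) d
    ≡⟨ cong (gauss (suc a) (k + b) d +_) (shift-small _ d<) ⟩
  gauss (suc a) (k + b) d + 0 ≡⟨ +-identityʳ _ ⟩
  gauss (suc a) (k + b) d     ≡⟨ gauss-stableʳ k (suc a) b d≤b ⟩
  gauss (suc a) b d           ∎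
  where
  d< : d < 2 * suc (k + b)
  d< = ≤-trans (s≤s (≤-trans d≤b (m≤n+m b k))) (m≤m+n (suc (k + b)) _)

-- Sums along antidiagonals

-- Indexing by pairs with a + b = N keeps both arguments of `gauss` natural numbers, while the
-- integer index j is recovered as an offset of `b`.
antidiagonal : (ℕ → ℕ → Series) → ℕ → Series
antidiagonal F zero    = F 0 0
antidiagonal F (suc N) = F 0 (suc N) ⊕ antidiagonal (λ a → F (suc a)) N

antidiagonal-cong-at : ∀ {F F′ : ℕ → ℕ → Series} N n →
  (∀ a b → a + b ≡ N → F a b n ≡ F′ a b n) → antidiagonal F N n ≡ antidiagonal F′ N n
antidiagonal-cong-at zero    n F≡F′ = F≡F′ 0 0 refl
antidiagonal-cong-at (suc N) n F≡F′ = cong₂ _+_ (F≡F′ 0 (suc N) refl)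
  (antidiagonal-cong-at N n λ a b a+b≡N → F≡F′ (suc a) b (cong suc a+b≡N))

antidiagonal-shift : ∀ k F N →
  shift k (antidiagonal F N) ≗ antidiagonal (λ a b → shift k (F a b)) N
antidiagonal-shift k F zero    n = refl
antidiagonal-shift k F (suc N) n = trans (shift-⊕ k (F 0 (suc N)) _ n)
  (cong (shift k (F 0 (suc N)) n +_) (antidiagonal-shift k (λ a → F (suc a)) N n))

antidiagonal-oddProduct : ∀ m F N →
  oddProduct m (antidiagonal F N) ≗ antidiagonal (λ a b → oddProduct m (F a b)) N
antidiagonal-oddProduct m F zero    n = refl
antidiagonal-oddProduct m F (suc N) n = trans (oddProduct-⊕ m (F 0 (suc N)) _ n)
  (cong (oddProduct m (F 0 (suc N)) n +_) (antidiagonal-oddProduct m (λ a → F (suc a)) N n))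

-- The form of `antidiagonal-split` that admits induction: the top entry of `F` is already replaced
-- by `B 0 N`, and each step passes to the families with first index raised by one.
antidiagonal-split-tail : ∀ (F A B : ℕ → ℕ → Series) →
  (∀ a → F (suc a) 0 ≗ A a 0) →
  (∀ a b → F (suc a) (suc b) ≗ A a (suc b) ⊕ B (suc a) b) →
  ∀ N → B 0 N ⊕ antidiagonal (λ a → F (suc a)) N ≗ antidiagonal A N ⊕ antidiagonal B N
antidiagonal-split-tail F A B bottom inner zero n =
  trans (cong (B 0 0 n +_) (bottom 0 n)) (+-comm (B 0 0 n) _)
antidiagonal-split-tail F A B bottom inner (suc N) n = begin
  B 0 (suc N) n + (F 1 (suc N) n + antidiagonal (λ a → F (suc (suc a))) N n)
    ≡⟨ cong (λ x → B 0 (suc N) n + (x + antidiagonal (λ a → F (suc (suc a))) N n)) (inner 0 N n) ⟩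
  B 0 (suc N) n + (A 0 (suc N) n + B 1 N n + antidiagonal (λ a → F (suc (suc a))) N n)
    ≡⟨ regroup (B 0 (suc N) n) (A 0 (suc N) n) (B 1 N n) _ ⟩
  A 0 (suc N) n + B 0 (suc N) n + (B 1 N n + antidiagonal (λ a → F (suc (suc a))) N n)
    ≡⟨ cong (A 0 (suc N) n + B 0 (suc N) n +_)
         (antidiagonal-split-tail (λ a → F (suc a)) (λ a → A (suc a)) (λ a → B (suc a))
           (λ a → bottom (suc a)) (λ a → inner (suc a)) N n) ⟩
  A 0 (suc N) n + B 0 (suc N) n
    + (antidiagonal (λ a → A (suc a)) N n + antidiagonal (λ a → B (suc a)) N n)
    ≡⟨ +-interchange (A 0 (suc N) n) _ _ _ ⟩
  antidiagonal A (suc N) n + antidiagonal B (suc N) n ∎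
  where
  regroup : ∀ w x y z → w + (x + y + z) ≡ x + w + (y + z)
  regroup = solve-∀

-- Pascal's rule summed over a row: an interior entry splits between its two neighbours on the
-- previous antidiagonal, and an end entry has just one neighbour.
antidiagonal-split : ∀ (F A B : ℕ → ℕ → Series) →
  (∀ b → F 0 (suc b) ≗ B 0 b) →
  (∀ a → F (suc a) 0 ≗ A a 0) →
  (∀ a b → F (suc a) (suc b) ≗ A a (suc b) ⊕ B (suc a) b) →
  ∀ N → antidiagonal F (suc N) ≗ antidiagonal A N ⊕ antidiagonal B N
antidiagonal-split F A B top bottom inner N n =
  trans (cong (_+ antidiagonal (λ a → F (suc a)) N n) (top N n))
        (antidiagonal-split-tail F A B bottom inner N n)

-- The finite form of Jacobi's triple product

-- The q-binomial theorem in base q². The new factor 1 + q^(2s+1) is absorbed by `gauss-pascal`,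
-- since (a+1)² + 2b = (2s+1) + a² when a + b = s.
oddProduct-one : ∀ s → oddProduct s one ≗ antidiagonal (λ a b → shift (a * a) (gauss a b)) s
oddProduct-one zero    n = refl
oddProduct-one (suc s) n = sym (begin
  antidiagonal F (suc s) n
    ≡⟨ antidiagonal-split F A B (λ _ _ → refl) (λ _ _ → refl) inner s n ⟩
  antidiagonal A s n + antidiagonal B s n
    ≡⟨ cong (_+ antidiagonal B s n)
         (antidiagonal-cong-at {A} {λ a b → shift k (B a b)} s n A≡) ⟩
  antidiagonal (λ a b → shift k (B a b)) s n + antidiagonal B s n
    ≡⟨ cong (_+ antidiagonal B s n) (antidiagonal-shift k B s n) ⟨
  shift k (antidiagonal B s) n + antidiagonal B s n
    ≡⟨ +-comm (shift k (antidiagonal B s) n) _ ⟩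
  times k (antidiagonal B s) n
    ≡⟨ times-cong k (oddProduct-one s) n ⟨
  times k (oddProduct s one) n ∎)
  where
  k = suc (2 * s)
  F A B : ℕ → ℕ → Series
  F a b = shift (a * a) (gauss a b)
  A a b = shift (suc a * suc a) (shift (2 * b) (gauss a b))
  B a b = shift (a * a) (gauss a b)

  inner : ∀ a b → F (suc a) (suc b) ≗ A a (suc b) ⊕ B (suc a) b
  inner a b m = begin
    shift (suc a * suc a) (gauss (suc a) (suc b)) m
      ≡⟨ shift-cong (suc a * suc a) (gauss-pascal a b) m ⟩
    shift (suc a * suc a) (gauss (suc a) b ⊕ shift (2 * suc b) (gauss a (suc b))) m
      ≡⟨ shift-⊕ (suc a * suc a) (gauss (suc a) b) _ m ⟩
    B (suc a) b m + A a (suc b) m ≡⟨ +-comm (B (suc a) b m) _ ⟩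
    A a (suc b) m + B (suc a) b m ∎

  exponent : ∀ a b → suc a * suc a + 2 * b ≡ suc (2 * (a + b)) + a * a
  exponent = solve-∀

  A≡ : ∀ a b → a + b ≡ s → A a b n ≡ shift k (B a b) n
  A≡ a b refl = begin
    shift (suc a * suc a) (shift (2 * b) (gauss a b)) n ≡⟨ shift-shift (suc a * suc a) (2 * b) _ n ⟩
    shift (suc a * suc a + 2 * b) (gauss a b) n
      ≡⟨ cong (λ i → shift i (gauss a b) n) (exponent a b) ⟩
    shift (k + a * a) (gauss a b) n                     ≡⟨ shift-shift k (a * a) _ n ⟨
    shift k (B a b) n                                   ∎

∣-∣² : ℕ → ℕ → ℕ
∣-∣² m n = ∣ m - n ∣ * ∣ m - n ∣

-- With x = b - s, (x+1)² - x² = 2x + 1, and adding 2a gives 2(a + b - s) + 1 = 2r + 1. The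
-- recursion lowers `b` and `s` together, preserving their difference, until one of them is zero.
∣-∣²-step : ∀ a b r s → a + b ≡ r + s → ∣-∣² (suc b) s + 2 * a ≡ suc (2 * r) + ∣-∣² b s
∣-∣²-step a b r zero eq with refl ← trans eq (+-identityʳ r) =
  trans (exponent a b) (cong (λ x → suc (2 * (a + b)) + x * x) (sym (∣-∣-identityʳ b)))
  where
  exponent : ∀ a b → suc b * suc b + 2 * a ≡ suc (2 * (a + b)) + b * b
  exponent = solve-∀
∣-∣²-step a zero r (suc s) eq with refl ← trans (sym (+-identityʳ a)) eq = exponent r s
  where
  exponent : ∀ r s → s * s + 2 * (r + suc s) ≡ suc (2 * r) + suc s * suc s
  exponent = solve-∀
∣-∣²-step a (suc b) r (suc s) eq =
  ∣-∣²-step a b r s (suc-injective (trans (sym (+-suc a b)) (trans eq (+-suc r s))))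

-- Induction on `r`, with j = b - s. The inner product gives the range -s ≤ j ≤ 0, and each outer
-- factor adds one positive value of j. Here the defining recursion of `gauss` is the suitable
-- q-Pascal rule: its weight q^(2a) is what `∣-∣²-step` turns into q^(2r+1).
finite-jacobi : ∀ r s → oddProduct r (oddProduct s one) ≗
                antidiagonal (λ a b → shift (∣-∣² b s) (gauss a b)) (r + s)
finite-jacobi zero s n = trans (oddProduct-one s n)
  (antidiagonal-cong-at s n λ { a b refl →
    cong (λ i → shift (i * i) (gauss a b) n) (distance a b) })
  where
  distance : ∀ a b → a ≡ ∣ b - a + b ∣
  distance a b = sym (trans (cong (λ x → ∣ b - x ∣) (+-comm a b)) (∣m-m+n∣≡n b a))
finite-jacobi (suc r) s n = sym (begin
  antidiagonal F (suc (r + s)) n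
    ≡⟨ antidiagonal-split F A B (λ _ _ → refl) (λ _ _ → refl) inner (r + s) n ⟩
  antidiagonal A (r + s) n + antidiagonal B (r + s) n
    ≡⟨ cong (antidiagonal A (r + s) n +_)
         (antidiagonal-cong-at {B} {λ a b → shift k (A a b)} (r + s) n B≡) ⟩
  antidiagonal A (r + s) n + antidiagonal (λ a b → shift k (A a b)) (r + s) n
    ≡⟨ cong (antidiagonal A (r + s) n +_) (antidiagonal-shift k A (r + s) n) ⟨
  times k (antidiagonal A (r + s)) n
    ≡⟨ times-cong k (finite-jacobi r s) n ⟨
  times k (oddProduct r (oddProduct s one)) n ∎)
  where
  k = suc (2 * r)
  F A B : ℕ → ℕ → Series
  F a b = shift (∣-∣² b s) (gauss a b)
  A a b = shift (∣-∣² b s) (gauss a b)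
  B a b = shift (∣-∣² (suc b) s) (shift (2 * a) (gauss a b))

  inner : ∀ a b → F (suc a) (suc b) ≗ A a (suc b) ⊕ B (suc a) b
  inner a b = shift-⊕ (∣-∣² (suc b) s) (gauss a (suc b)) _

  B≡ : ∀ a b → a + b ≡ r + s → B a b n ≡ shift k (A a b) n
  B≡ a b a+b≡ = begin
    shift (∣-∣² (suc b) s) (shift (2 * a) (gauss a b)) n
      ≡⟨ shift-shift (∣-∣² (suc b) s) (2 * a) _ n ⟩
    shift (∣-∣² (suc b) s + 2 * a) (gauss a b) n
      ≡⟨ cong (λ i → shift i (gauss a b) n) (∣-∣²-step a b r s a+b≡) ⟩
    shift (k + ∣-∣² b s) (gauss a b) n
      ≡⟨ shift-shift k (∣-∣² b s) _ n ⟨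
    shift k (A a b) n ∎

-- Enumeration of pod partitions

private
  variable
    A : Set

unique-length : ∀ {xs ys : List A} → Unique xs → Unique ys →
                (∀ {z} → z ∈ xs ⇔ z ∈ ys) → length xs ≡ length ys
unique-length uxs uys eq = ↭-length (∼bag⇒↭ (unique∧set⇒bag uxs uys eq))

justEmpty : ℕ → List (List A)
justEmpty zero    = [] ∷ []
justEmpty (suc _) = []

length-justEmpty : ∀ n → length (justEmpty {A} n) ≡ one n
length-justEmpty zero    = refl
length-justEmpty (suc _) = refl

justEmpty-unique : ∀ n → Unique (justEmpty {A} n)
justEmpty-unique zero    = [] ∷ []
justEmpty-unique (suc _) = []

-- The combinatorial counterpart of shift: adds the part x, of size k.
prepend : A → ℕ → (ℕ → List (List A)) → ℕ → List (List A)
prepend x zero    f n       = map (x ∷_) (f n)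
prepend x (suc k) f zero    = []
prepend x (suc k) f (suc n) = prepend x k f n

length-prepend : ∀ (x : A) k f n → length (prepend x k f n) ≡ shift k (length ∘ f) n
length-prepend x zero    f n       = length-map (x ∷_) (f n)
length-prepend x (suc k) f zero    = refl
length-prepend x (suc k) f (suc n) = length-prepend x k f n

prepend-unique : ∀ (x : A) k {f} → (∀ n → Unique (f n)) → ∀ n → Unique (prepend x k f n)
prepend-unique x zero    uf n       = Unique.map⁺ ∷-injectiveʳ (uf n)
prepend-unique x (suc k) uf zero    = []
prepend-unique x (suc k) uf (suc n) = prepend-unique x k uf n

∈-prepend⁺ : ∀ {x : A} k {f n xs} → xs ∈ f n → x ∷ xs ∈ prepend x k f (k + n)
∈-prepend⁺ {x = x} zero xs∈ = ∈-map⁺ (x ∷_) xs∈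
∈-prepend⁺ (suc k) xs∈ = ∈-prepend⁺ k xs∈

∈-prepend⁻ : ∀ (x : A) k f n {ys} → ys ∈ prepend x k f n →
             ∃₂ λ m xs → ys ≡ x ∷ xs × k + m ≡ n × xs ∈ f m
∈-prepend⁻ x zero f n ys∈ with xs , xs∈ , refl ← ∈-map⁻ (x ∷_) ys∈ = n , xs , refl , refl , xs∈
∈-prepend⁻ x (suc k) f (suc n) ys∈
  with m , xs , eq , refl , xs∈ ← ∈-prepend⁻ x k f n ys∈ = m , xs , eq , refl , xs∈

-- Building pod partitions from their largest part

even-or-odd-or-≤ : ∀ {k} a → k ≤ 2 * suc a → k ≡ 2 * suc a ⊎ k ≡ suc (2 * a) ⊎ k ≤ 2 * a
even-or-odd-or-≤ {k} a k≤ with m≤n⇒m<n∨m≡n k≤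
... | inj₂ k≡ = inj₁ k≡
... | inj₁ k< with m≤n⇒m<n∨m≡n (m<1+n⇒m≤n (subst (k <_) (*-suc 2 a) k<))
...   | inj₂ k≡ = inj₂ (inj₁ k≡)
...   | inj₁ k<′ = inj₂ (inj₂ (m<1+n⇒m≤n k<′))

2*k-even : ∀ k → ¬ Odd (2 * k)
2*k-even k odd = odd (m∣m*n k)

1+2*k-odd : ∀ k → Odd (suc (2 * k))
1+2*k-odd k (divides q eq) = even≢odd q k (trans (*-comm 2 q) (sym eq))

linked-cons : ∀ {x xs} → All (_≤ x) xs → Linked _≥_ xs → Linked _≥_ (x ∷ xs)
linked-cons []        []  = [-]
linked-cons (y≤x ∷ _) xs≥ = y≤x ∷ xs≥

isPodPartition-cons : ∀ {x n xs} → 0 < x → All (_≤ x) xs → (Odd x → All (x ≢_) xs) →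
                      IsPodPartition n xs → IsPodPartition (x + n) (x ∷ xs)
isPodPartition-cons {x} {xs = xs} 0<x x≥ x≢ ((≥xs , pos , total) , distinct) =
  (linked-cons x≥ ≥xs , 0<x ∷ pos , cong (x +_) total) , distinct′
  where
  distinct′ : Unique (filter odd? (x ∷ xs))
  distinct′ = case odd? x of λ where
    (yes o) → subst Unique (sym (filter-accept odd? o)) (All.filter⁺ odd? (x≢ o) ∷ distinct)
    (no ¬o) → subst Unique (sym (filter-reject odd? ¬o)) distinct

isPodPartition-uncons : ∀ {x n xs} → IsPodPartition n (x ∷ xs) →
  All (_≤ x) xs × (Odd x → All (x ≢_) xs) × IsPodPartition (sum xs) xs
isPodPartition-uncons {x} {n} {xs} ((≥xs , _ ∷ pos , _) , distinct)
  with x≥ ∷ ≥xs′ ← Linked⇒AllPairs (flip ≤-trans) ≥xs =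
  x≥ , x≢ , (AllPairs⇒Linked ≥xs′ , pos , refl) , tail-distinct
  where
  x≢ : Odd x → All (x ≢_) xs
  x≢ o with x≢odds ∷ _ ← subst Unique (filter-accept odd? {xs = xs} o) distinct =
    -- An entry equal to the odd number `x` is itself odd, so it survives the filter and meets the
    -- distinctness there.
    All.tabulate λ { x∈xs refl → All.lookup x≢odds (∈-filter⁺ odd? x∈xs o) refl }

  tail-distinct : Unique (filter odd? xs)
  tail-distinct = case odd? x of λ where
    (yes o) → AllPairs.tail (subst Unique (filter-accept odd? o) distinct)
    (no ¬o) → subst Unique (filter-reject odd? ¬o) distinct

-- The part 2a + 1 is used once or not at all: the combinatorial counterpart of the factor 1 +
-- q^(2a+1).
withOddPart : ℕ → (ℕ → List (List ℕ)) → ℕ → List (List ℕ)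
withOddPart a f n = f n ++ prepend (suc (2 * a)) (suc (2 * a)) f n

-- The pod partitions of n with all parts at most 2a and at most b even parts.
boundedPods : ℕ → ℕ → ℕ → List (List ℕ)
boundedPods zero    b       n = justEmpty n
boundedPods (suc a) zero    n = withOddPart a (boundedPods a zero) n
boundedPods (suc a) (suc b) n =
  withOddPart a (boundedPods a (suc b)) n ++
  prepend (2 * suc a) (2 * suc a) (boundedPods (suc a) b) n

-- The bound on the parts accompanies soundness because it keeps the list weakly decreasing, and a
-- new odd part distinct from the rest, when a larger part is prepended.
SoundBelow : ℕ → (ℕ → List (List ℕ)) → Set
SoundBelow k f = ∀ n {xs} → xs ∈ f n → All (_≤ k) xs × IsPodPartition n xs

withOddPart-sound : ∀ a {f} → SoundBelow (2 * a) f → SoundBelow (suc (2 * a)) (withOddPart a f)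
withOddPart-sound a {f} sound n xs∈ with ∈-++⁻ (f n) xs∈
... | inj₁ xs∈f with xs≤ , pod ← sound n xs∈f = All.map m≤n⇒m≤1+n xs≤ , pod
... | inj₂ xs∈′ with m , ys , refl , refl , ys∈ ← ∈-prepend⁻ (suc (2 * a)) (suc (2 * a)) f n xs∈′
  with ys≤ , pod ← sound m ys∈ =
  ≤-refl ∷ ys≤′ , isPodPartition-cons (s≤s z≤n) ys≤′
    (λ _ → All.map (λ y≤ → ≢-sym (<⇒≢ (s≤s y≤))) ys≤) pod
  where
  ys≤′ = All.map m≤n⇒m≤1+n ys≤

1+2*a≤2*[1+a] : ∀ a → suc (2 * a) ≤ 2 * suc a
1+2*a≤2*[1+a] a = ≤-trans (n≤1+n _) (≤-reflexive (sym (*-suc 2 a)))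

boundedPods-sound : ∀ a b → SoundBelow (2 * a) (boundedPods a b)
boundedPods-sound zero b zero (here refl) = [] , ([] , [] , refl) , []
boundedPods-sound (suc a) zero n xs∈
  with xs≤ , pod ← withOddPart-sound a (boundedPods-sound a zero) n xs∈ =
  All.map (λ x≤ → ≤-trans x≤ (1+2*a≤2*[1+a] a)) xs≤ , pod
boundedPods-sound (suc a) (suc b) n xs∈ with ∈-++⁻ (withOddPart a (boundedPods a (suc b)) n) xs∈
... | inj₁ xs∈′ with xs≤ , pod ← withOddPart-sound a (boundedPods-sound a (suc b)) n xs∈′ =
  All.map (λ x≤ → ≤-trans x≤ (1+2*a≤2*[1+a] a)) xs≤ , pod
... | inj₂ xs∈′
  with m , ys , refl , refl , ys∈ ←
    ∈-prepend⁻ (2 * suc a) (2 * suc a) (boundedPods (suc a) b) n xs∈′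
  with ys≤ , pod ← boundedPods-sound (suc a) b m ys∈ =
  ≤-refl ∷ ys≤ , isPodPartition-cons (s≤s z≤n) ys≤ (λ o → contradiction o (2*k-even (suc a))) pod

-- The two halves are disjoint because one has parts at most 2a and the other begins with 2a + 1.
withOddPart-unique : ∀ a {f} → SoundBelow (2 * a) f →
                     (∀ n → Unique (f n)) → ∀ n → Unique (withOddPart a f n)
withOddPart-unique a {f} sound uf n = Unique.++⁺ (uf n) (prepend-unique _ (suc (2 * a)) uf n)
  λ { (xs∈ , xs∈′) → disjoint xs∈ xs∈′ }
  where
  disjoint : ∀ {xs} → xs ∈ f n → ¬ xs ∈ prepend (suc (2 * a)) (suc (2 * a)) f n
  disjoint xs∈ xs∈′ with m , ys , refl , _ ← ∈-prepend⁻ (suc (2 * a)) (suc (2 * a)) f n xs∈′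
    with x≤ ∷ _ , _ ← sound n xs∈ = 1+n≰n x≤

boundedPods-unique : ∀ a b n → Unique (boundedPods a b n)
boundedPods-unique zero b n = justEmpty-unique n
boundedPods-unique (suc a) zero n =
  withOddPart-unique a (boundedPods-sound a zero) (boundedPods-unique a zero) n
boundedPods-unique (suc a) (suc b) n = Unique.++⁺
  (withOddPart-unique a (boundedPods-sound a (suc b)) (boundedPods-unique a (suc b)) n)
  (prepend-unique _ (2 * suc a) (boundedPods-unique (suc a) b) n)
  λ { (xs∈ , xs∈′) → disjoint xs∈ xs∈′ }
  where
  disjoint : ∀ {xs} → xs ∈ withOddPart a (boundedPods a (suc b)) n →
             ¬ xs ∈ prepend (2 * suc a) (2 * suc a) (boundedPods (suc a) b) n
  disjoint xs∈ xs∈′ with m , ys , refl , _ ←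
      ∈-prepend⁻ (2 * suc a) (2 * suc a) (boundedPods (suc a) b) n xs∈′
    with x≤ ∷ _ , _ ← withOddPart-sound a (boundedPods-sound a (suc b)) n xs∈ =
    1+n≰n (≤-trans (≤-reflexive (sym (*-suc 2 a))) x≤)

-- Bounding the number of all parts by `b` also bounds the number of even ones, and a bound on the
-- length passes directly to tails. The cases are largest part 2a + 2, 2a + 1, or at most 2a.
boundedPods-complete : ∀ a b n {xs} → length xs ≤ b → All (_≤ 2 * a) xs →
                       IsPodPartition n xs → xs ∈ boundedPods a b n
boundedPods-complete zero b n {[]} _ _ ((_ , _ , refl) , _) = here refl
boundedPods-complete zero b n {x ∷ xs} _ (x≤0 ∷ _) ((_ , 0<x ∷ _ , _) , _) =
  contradiction x≤0 (<⇒≱ 0<x)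
boundedPods-complete (suc a) zero n {[]} _ _ pod = ∈-++⁺ˡ (boundedPods-complete a zero n z≤n [] pod)
boundedPods-complete (suc a) (suc b) n {[]} _ _ pod =
  ∈-++⁺ˡ (∈-++⁺ˡ (boundedPods-complete a (suc b) n z≤n [] pod))
boundedPods-complete (suc a) (suc b) n {x ∷ xs} l≤@(s≤s l≤′) (x≤ ∷ xs≤) pod@((_ , _ , refl) , _)
  with isPodPartition-uncons pod
... | x≥ , x≢ , pod′ with even-or-odd-or-≤ a x≤
...   | inj₁ refl = ∈-++⁺ʳ (withOddPart a (boundedPods a (suc b)) n)
        (∈-prepend⁺ (2 * suc a) {boundedPods (suc a) b}
          (boundedPods-complete (suc a) b _ l≤′ xs≤ pod′))
-- An odd part does not consume the allowance `b` of even parts, so the bound on the length of the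
-- tail is relaxed by one.
...   | inj₂ (inj₁ refl) = ∈-++⁺ˡ (∈-++⁺ʳ (boundedPods a (suc b) n)
        (∈-prepend⁺ (suc (2 * a)) {boundedPods a (suc b)}
          (boundedPods-complete a (suc b) _ (m≤n⇒m≤1+n l≤′) xs≤2a pod′)))
  where
  xs≤2a : All (_≤ 2 * a) xs
  xs≤2a = All.zipWith (λ { (y≤x , x≢y) → m<1+n⇒m≤n (≤∧≢⇒< y≤x (≢-sym x≢y)) })
            (x≥ , x≢ (1+2*k-odd a))
...   | inj₂ (inj₂ x≤2a) = ∈-++⁺ˡ (∈-++⁺ˡ (boundedPods-complete a (suc b) _ l≤
        (x≤2a ∷ All.map (λ y≤x → ≤-trans y≤x x≤2a) x≥) pod))

length-withOddPart : ∀ a f → length ∘ withOddPart a f ≗ times (suc (2 * a)) (length ∘ f)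
length-withOddPart a f n =
  trans (length-++ (f n)) (cong (length (f n) +_) (length-prepend _ (suc (2 * a)) f n))

-- `boundedPods` follows the recursion of `gauss`, with one factor 1 + q^(2a+1) for each new odd
-- size. Commuting `oddProduct` with `shift` brings the even part's weight next to `gauss`.
length-boundedPods : ∀ a b → length ∘ boundedPods a b ≗ oddProduct a (gauss a b)
length-boundedPods zero b n = length-justEmpty n
length-boundedPods (suc a) zero n = trans (length-withOddPart a (boundedPods a zero) n)
  (times-cong (suc (2 * a)) (length-boundedPods a zero) n)
length-boundedPods (suc a) (suc b) n = begin
  length (boundedPods (suc a) (suc b) n)
    ≡⟨ length-++ (withOddPart a (boundedPods a (suc b)) n) ⟩
  length (withOddPart a (boundedPods a (suc b)) n)
    + length (prepend (2 * suc a) (2 * suc a) (boundedPods (suc a) b) n)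
    ≡⟨ cong₂ _+_ (length-withOddPart a (boundedPods a (suc b)) n)
                 (length-prepend _ (2 * suc a) (boundedPods (suc a) b) n) ⟩
  times k (length ∘ boundedPods a (suc b)) n
    + shift (2 * suc a) (length ∘ boundedPods (suc a) b) n
    ≡⟨ cong₂ _+_ (times-cong k (length-boundedPods a (suc b)) n)
                 (shift-cong (2 * suc a) (length-boundedPods (suc a) b) n) ⟩
  oddProduct (suc a) (gauss a (suc b)) n
    + shift (2 * suc a) (oddProduct (suc a) (gauss (suc a) b)) n
    ≡⟨ cong (oddProduct (suc a) (gauss a (suc b)) n +_)
         (oddProduct-shift (suc a) (2 * suc a) (gauss (suc a) b) n) ⟨
  oddProduct (suc a) (gauss a (suc b)) n
    + oddProduct (suc a) (shift (2 * suc a) (gauss (suc a) b)) n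
    ≡⟨ oddProduct-⊕ (suc a) (gauss a (suc b)) _ n ⟨
  oddProduct (suc a) (gauss (suc a) (suc b)) n ∎
  where k = suc (2 * a)

-- A partition of `n` has at most `n` parts, each at most n ≤ 2n, so both bounds of
-- `boundedPods n n` hold automatically.
length-podPartitions : ∀ n → length (podPartitions n) ≡ oddProduct n (gauss n n) n
length-podPartitions n = trans
  (unique-length (podPartitions-unique n) (boundedPods-unique n n n) (mk⇔ to from))
  (length-boundedPods n n n)
  where
  to : ∀ {xs} → xs ∈ podPartitions n → xs ∈ boundedPods n n n
  to {xs} xs∈ with Equivalence.to (∈-podPartitions n xs) xs∈
  ... | pod@((_ , pos , refl) , _) = boundedPods-complete n n n
    (subst (length xs ≤_) (cong sum (map-id xs)) (length≤total (λ k → k) pos))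
    (All.map (λ x≤ → ≤-trans (subst (_ ≤_) (cong sum (map-id xs)) x≤) (m≤m+n n _))
      (size≤total (λ k → k) xs)) pod

  from : ∀ {xs} → xs ∈ boundedPods n n n → xs ∈ podPartitions n
  from xs∈ = Equivalence.from (∈-podPartitions n _) (proj₂ (boundedPods-sound n n n xs∈))

-- Enumeration of tricoloured partitions
module _ {R : Rel A 0ℓ} where

  AllPairs-resp-⊆ : ∀ {xs ys} → xs ⊆ ys → AllPairs R ys → AllPairs R xs
  AllPairs-resp-⊆ []            []       = []
  AllPairs-resp-⊆ (_ ∷ʳ xs⊆)    (_ ∷ ps) = AllPairs-resp-⊆ xs⊆ ps
  AllPairs-resp-⊆ (refl ∷ xs⊆)  (p ∷ ps) = All-resp-⊆ xs⊆ p ∷ AllPairs-resp-⊆ xs⊆ ps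

  -- Walk along `ys`. If its head is the head of `xs`, asymmetry prevents a recurrence later in
  -- `xs`; otherwise that head precedes `x` in the order and so cannot occur after `x` in `xs`.
  sorted⇒⊆ : Asymmetric R → ∀ {xs ys} → AllPairs R xs → AllPairs R ys → All (_∈ ys) xs → xs ⊆ ys
  sorted⇒⊆ asym {[]} _ _ _ = minimum _
  sorted⇒⊆ asym {x ∷ xs} {y ∷ ys} (x> ∷ sxs) (y> ∷ sys) (here refl ∷ xs∈) =
    refl ∷ sorted⇒⊆ asym sxs sys (All.zipWith inTail (x> , xs∈))
    where
    inTail : ∀ {z} → R x z × z ∈ x ∷ ys → z ∈ ys
    inTail (xRz , here refl) = contradiction xRz (asym xRz)
    inTail (_   , there z∈)  = z∈
  sorted⇒⊆ asym {x ∷ xs} {y ∷ ys} (x> ∷ sxs) (y> ∷ sys) (there x∈ ∷ xs∈) =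
    y ∷ʳ sorted⇒⊆ asym (x> ∷ sxs) sys (x∈ ∷ All.zipWith inTail (x> , xs∈))
    where
    inTail : ∀ {z} → R x z × z ∈ y ∷ ys → z ∈ ys
    inTail (xRz , here refl) = contradiction xRz (asym (All.lookup y> x∈))
    inTail (_   , there z∈)  = z∈

≻-trans : Transitive _≻_
≻-trans = ×-transitive {_<₂_ = Fin._>_ {3} {3}} isEquivalence (resp₂ _>_)
            (flip <-trans) (flip Fin.<-trans)

≻-asym : Asymmetric _≻_
≻-asym = ×-asymmetric {_<₂_ = Fin._>_ {3} {3}} sym (resp₂ _>_)
           (λ p q → <-asym p q) (λ p q → <-asym p q)

-- Tricoloured partitions as sublists of a fixed list

sublistsWithSum : List ColouredPart → ℕ → List (List ColouredPart)
sublistsWithSum []       n = justEmpty n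
sublistsWithSum (p ∷ ps) n = sublistsWithSum ps n ++ prepend p (proj₁ p) (sublistsWithSum ps) n

sublistsWithSum-sound : ∀ ps n {xs} → xs ∈ sublistsWithSum ps n → xs ⊆ ps × sum (map proj₁ xs) ≡ n
sublistsWithSum-sound [] zero (here refl) = [] , refl
sublistsWithSum-sound (p ∷ ps) n xs∈ with ∈-++⁻ (sublistsWithSum ps n) xs∈
... | inj₁ xs∈′ with xs⊆ , total ← sublistsWithSum-sound ps n xs∈′ = p ∷ʳ xs⊆ , total
... | inj₂ xs∈′
  with m , ys , refl , refl , ys∈ ← ∈-prepend⁻ p (proj₁ p) (sublistsWithSum ps) n xs∈′
  with ys⊆ , total ← sublistsWithSum-sound ps m ys∈ = refl ∷ ys⊆ , cong (proj₁ p +_) total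

sublistsWithSum-complete : ∀ {xs ps} → xs ⊆ ps → xs ∈ sublistsWithSum ps (sum (map proj₁ xs))
sublistsWithSum-complete []           = here refl
sublistsWithSum-complete (_ ∷ʳ xs⊆)   = ∈-++⁺ˡ (sublistsWithSum-complete xs⊆)
sublistsWithSum-complete {p ∷ xs} {_ ∷ ps} (refl ∷ xs⊆) =
  ∈-++⁺ʳ (sublistsWithSum ps (sum (map proj₁ (p ∷ xs))))
    (∈-prepend⁺ (proj₁ p) {sublistsWithSum ps} (sublistsWithSum-complete xs⊆))

sublistsWithSum-unique : ∀ {ps} → Unique ps → ∀ n → Unique (sublistsWithSum ps n)
sublistsWithSum-unique [] n = justEmpty-unique n
sublistsWithSum-unique {p ∷ ps} (p∉ps ∷ ups) n = Unique.++⁺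
  (sublistsWithSum-unique ups n)
  (prepend-unique p (proj₁ p) (sublistsWithSum-unique ups) n)
  λ { (xs∈ , xs∈′) → disjoint xs∈ xs∈′ }
  where
  disjoint : ∀ {xs} → xs ∈ sublistsWithSum ps n → ¬ xs ∈ prepend p (proj₁ p) (sublistsWithSum ps) n
  disjoint xs∈ xs∈′
    with m , ys , refl , _ ← ∈-prepend⁻ p (proj₁ p) (sublistsWithSum ps) n xs∈′
    with xs⊆ , _ ← sublistsWithSum-sound ps n xs∈ =
    All.lookup p∉ps (lookup xs⊆ (here refl)) refl

-- Each available part is skipped or taken once, which contributes the factor 1 + q^size.
length-sublistsWithSum-∷ : ∀ p ps → length ∘ sublistsWithSum (p ∷ ps) ≗
                           times (proj₁ p) (length ∘ sublistsWithSum ps)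
length-sublistsWithSum-∷ p ps n = trans (length-++ (sublistsWithSum ps n))
  (cong (length (sublistsWithSum ps n) +_) (length-prepend p (proj₁ p) (sublistsWithSum ps) n))

-- Listed in descending `_≻_` order, larger sizes and then larger colours first, so that tricoloured
-- partitions with parts below 2m are its sublists.
oddParts : ℕ → List ColouredPart
oddParts zero    = []
oddParts (suc m) = (k , suc (suc zero)) ∷ (k , suc zero) ∷ (k , zero) ∷ oddParts m
  where k = suc (2 * m)

oddParts-bound : ∀ m → All (λ p → proj₁ p < suc (2 * m)) (oddParts m)
oddParts-bound zero    = []
oddParts-bound (suc m) = k< ∷ k< ∷ k< ∷ All.map (λ p< → <-trans p< k<) (oddParts-bound m)
  where
  k< : suc (2 * m) < suc (2 * suc m)
  k< = s≤s (1+2*a≤2*[1+a] m)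

oddParts-sorted : ∀ m → AllPairs _≻_ (oddParts m)
oddParts-sorted zero    = []
oddParts-sorted (suc m) =
  (inj₂ (refl , s≤s (s≤s z≤n)) ∷ inj₂ (refl , s≤s z≤n) ∷ smaller) ∷
  (inj₂ (refl , s≤s z≤n) ∷ smaller) ∷ smaller ∷ oddParts-sorted m
  where
  smaller : ∀ {c} → All ((suc (2 * m) , c) ≻_) (oddParts m)
  smaller = All.map inj₁ (oddParts-bound m)

oddParts-odd : ∀ m → All (Odd ∘ proj₁) (oddParts m)
oddParts-odd zero    = []
oddParts-odd (suc m) = o ∷ o ∷ o ∷ oddParts-odd m
  where o = 1+2*k-odd m

∈-oddParts : ∀ m {k c} → Odd k → k ≤ 2 * m → (k , c) ∈ oddParts m
∈-oddParts zero {zero} o _ = contradiction o (2*k-even 0)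
∈-oddParts (suc m) {c = c} o k≤ with even-or-odd-or-≤ m k≤
... | inj₁ refl        = contradiction o (2*k-even (suc m))
... | inj₂ (inj₂ k≤2m) = there (there (there (∈-oddParts m o k≤2m)))
... | inj₂ (inj₁ refl) with c
...   | zero         = there (there (here refl))
...   | suc zero     = there (here refl)
...   | suc (suc zero) = here refl

-- The three colours of size 2m + 1 give three equal factors in front; `oddProduct-times` moves them
-- inward until each of the three products has one.
length-sublistsWithSum-oddParts : ∀ m → length ∘ sublistsWithSum (oddParts m) ≗
                                  oddProduct m (oddProduct m (oddProduct m one))
length-sublistsWithSum-oddParts zero    n = length-justEmpty n
length-sublistsWithSum-oddParts (suc m) n = begin
  length (sublistsWithSum (oddParts (suc m)) n)
    ≡⟨ length-sublistsWithSum-∷ (part (suc (suc zero)))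
         (part (suc zero) ∷ part zero ∷ oddParts m) n ⟩
  times k (length ∘ sublistsWithSum (part (suc zero) ∷ part zero ∷ oddParts m)) n
    ≡⟨ times-cong k (length-sublistsWithSum-∷ (part (suc zero)) (part zero ∷ oddParts m)) n ⟩
  times k (times k (length ∘ sublistsWithSum (part zero ∷ oddParts m))) n
    ≡⟨ times-cong k (times-cong k (length-sublistsWithSum-∷ (part zero) (oddParts m))) n ⟩
  times k (times k (times k (length ∘ sublistsWithSum (oddParts m)))) n
    ≡⟨ times-cong k (times-cong k (times-cong k (length-sublistsWithSum-oddParts m))) n ⟩
  times k (times k (times k (P (P (P one))))) n
    ≡⟨ times-cong k (times-cong k (oddProduct-times m k (P (P one)))) n ⟨
  times k (times k (P (times k (P (P one))))) n
    ≡⟨ times-cong k (oddProduct-times m k (times k (P (P one)))) n ⟨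
  times k (P (times k (times k (P (P one))))) n
    ≡⟨ times-cong k (oddProduct-cong m (times-cong k (oddProduct-times m k (P one)))) n ⟨
  times k (P (times k (P (times k (P one))))) n ∎
  where
  k = suc (2 * m)
  P = oddProduct m

  part : Fin 3 → ColouredPart
  part c = k , c

qodd'''-oddProduct : ∀ n → qodd''' n ≡ oddProduct n (oddProduct n (oddProduct n one)) n
qodd'''-oddProduct n = trans
  (unique-length (oddTricolouredPartitions-unique n)
    (sublistsWithSum-unique (AllPairs.map (λ { p≻p refl → ≻-asym p≻p p≻p }) (oddParts-sorted n)) n)
    (mk⇔ to from))
  (length-sublistsWithSum-oddParts n n)
  where
  to : ∀ {xs} → xs ∈ oddTricolouredPartitions n → xs ∈ sublistsWithSum (oddParts n) n
  to {xs} xs∈ with Equivalence.to (∈-oddTricolouredPartitions n xs) xs∈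
  ... | sorted , odds , refl = sublistsWithSum-complete
    (sorted⇒⊆ ≻-asym (Linked⇒AllPairs ≻-trans sorted) (oddParts-sorted n)
      (All.zipWith (λ { (o , k≤) → ∈-oddParts n o (≤-trans k≤ (m≤m+n n _)) })
        (odds , size≤total proj₁ xs)))

  from : ∀ {xs} → xs ∈ sublistsWithSum (oddParts n) n → xs ∈ oddTricolouredPartitions n
  from xs∈ with sublistsWithSum-sound (oddParts n) n xs∈
  ... | xs⊆ , total = Equivalence.from (∈-oddTricolouredPartitions n _)
    (AllPairs⇒Linked (AllPairs-resp-⊆ xs⊆ (oddParts-sorted n)) ,
     All-resp-⊆ xs⊆ (oddParts-odd n) , total)

-- The sum over squares

-- Opened only here: with the prefix +_ in scope, sections (x +_) are ambiguous.
open import Data.Integer as ℤ using (ℤ; +_; -[1+_]; _-_; _^_; _⊖_)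
import Data.Integer.Properties as ℤ

-- Up to degree `d`, stability reduces `n`, `a` and `b` all to `d`, where `length-podPartitions`
-- applies.
oddProduct-gauss-pod : ∀ {a b n d} → d ≤ a → d ≤ b → d ≤ n → oddProduct n (gauss a b) d ≡ pod (+ d)
oddProduct-gauss-pod {a} {b} {n} {d} d≤a d≤b d≤n = begin
  oddProduct n (gauss a b) d
    ≡⟨ cong (λ m → oddProduct m (gauss a b) d) (m∸n+n≡m d≤n) ⟨
  oddProduct (n ∸ d + d) (gauss a b) d
    ≡⟨ oddProduct-stable (n ∸ d) d (gauss a b) ≤-refl ⟩
  oddProduct d (gauss a b) d
    ≡⟨ oddProduct-cong-below d stable d ≤-refl ⟩
  oddProduct d (gauss d d) d
    ≡⟨ length-podPartitions d ⟨
  pod (+ d) ∎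
  where
  stable : ∀ e → e ≤ d → gauss a b e ≡ gauss d d e
  stable e e≤d = begin
    gauss a b e           ≡⟨ cong₂ (λ i j → gauss i j e) (m∸n+n≡m d≤a) (m∸n+n≡m d≤b) ⟨
    gauss (a ∸ d + d) (b ∸ d + d) e ≡⟨ gauss-stableˡ (a ∸ d) d (b ∸ d + d) e≤d ⟩
    gauss d (b ∸ d + d) e ≡⟨ gauss-stableʳ (b ∸ d) d d e≤d ⟩
    gauss d d e           ∎

-- Below degree `k` the zeros of `shift` agree with the convention that `pod` vanishes at negative
-- integers.
shift-pod : ∀ k n → shift k (pod ∘ +_) n ≡ pod (n ⊖ k)
shift-pod zero    n       = refl
shift-pod (suc k) zero    = refl
shift-pod (suc k) (suc n) = trans (shift-pod k n) (cong pod (sym (ℤ.[1+m]⊖[1+n]≡m⊖n n k)))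

square-abs : ∀ i → i ^ 2 ≡ + (ℤ.∣ i ∣ * ℤ.∣ i ∣)
square-abs (+ n) = trans (cong (+ n ℤ.*_) (ℤ.*-identityʳ (+ n))) (sym (ℤ.pos-* n n))
square-abs -[1+ n ] = cong (-[1+ n ] ℤ.*_) (ℤ.*-identityʳ -[1+ n ])

pod-minus-square : ∀ n j → pod (+ n - j ^ 2) ≡ shift (ℤ.∣ j ∣ * ℤ.∣ j ∣) (pod ∘ +_) n
pod-minus-square n j = begin
  pod (+ n - j ^ 2)             ≡⟨ cong (λ i → pod (+ n - i)) (square-abs j) ⟩
  pod (+ n - + (ℤ.∣ j ∣ * ℤ.∣ j ∣)) ≡⟨ cong pod (ℤ.m-n≡m⊖n n (ℤ.∣ j ∣ * ℤ.∣ j ∣)) ⟩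
  pod (n ⊖ (ℤ.∣ j ∣ * ℤ.∣ j ∣))     ≡⟨ shift-pod (ℤ.∣ j ∣ * ℤ.∣ j ∣) n ⟨
  shift (ℤ.∣ j ∣ * ℤ.∣ j ∣) (pod ∘ +_) n ∎

∣m⊖n∣≡∣m-n∣ : ∀ m n → ℤ.∣ m ⊖ n ∣ ≡ ∣ m - n ∣
∣m⊖n∣≡∣m-n∣ zero    zero    = refl
∣m⊖n∣≡∣m-n∣ zero    (suc n) = refl
∣m⊖n∣≡∣m-n∣ (suc m) zero    = refl
∣m⊖n∣≡∣m-n∣ (suc m) (suc n) = trans (cong ℤ.∣_∣ (ℤ.[1+m]⊖[1+n]≡m⊖n m n)) (∣m⊖n∣≡∣m-n∣ m n)

m≤m*m : ∀ m → m ≤ m * m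
m≤m*m zero    = z≤n
m≤m*m (suc m) = m≤m*n (suc m) (suc m)

-- The change of index j = b - n, taking 0 ≤ b ≤ 2n to -n ≤ j ≤ n.
centred : ℕ → ℕ → ℤ
centred n b = + b - + n

-- Let t = |b - n|. Only degrees with d + t² = n contribute, and there d ≤ n - t because t ≤ t².
-- Since a + b = 2n, both `a` and `b` are at least n - t, so the bounds of `oddProduct-gauss-pod`
-- are met.
oddProduct-jacobi-term : ∀ n a b → a + b ≡ n + n →
  oddProduct n (shift (∣-∣² b n) (gauss a b)) n ≡ pod (+ n - centred n b ^ 2)
oddProduct-jacobi-term n a b a+b≡n+n = begin
  oddProduct n (shift (∣-∣² b n) (gauss a b)) n
    ≡⟨ oddProduct-shift n (∣-∣² b n) (gauss a b) n ⟩
  shift (∣-∣² b n) (oddProduct n (gauss a b)) n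
    ≡⟨ shift-cong-at (∣-∣² b n) n (λ d d+sq≡n → oddProduct-gauss-pod
         (+-cancelʳ-≤ t d a (≤-trans (d+t≤n d d+sq≡n) n≤a+t))
         (+-cancelʳ-≤ t d b (≤-trans (d+t≤n d d+sq≡n) (m≤n+∣n-m∣ n b)))
         (m+n≤o⇒m≤o d (d+t≤n d d+sq≡n))) ⟩
  shift (∣-∣² b n) (pod ∘ +_) n
    ≡⟨ cong (λ k → shift (k * k) (pod ∘ +_) n)
         (trans (cong ℤ.∣_∣ (ℤ.m-n≡m⊖n b n)) (∣m⊖n∣≡∣m-n∣ b n)) ⟨
  shift (ℤ.∣ centred n b ∣ * ℤ.∣ centred n b ∣) (pod ∘ +_) n
    ≡⟨ pod-minus-square n (centred n b) ⟨
  pod (+ n - centred n b ^ 2) ∎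
  where
  t = ∣ b - n ∣

  d+t≤n : ∀ d → d + ∣-∣² b n ≡ n → d + t ≤ n
  d+t≤n d d+sq≡n = ≤-trans (+-monoʳ-≤ d (m≤m*m t)) (≤-reflexive d+sq≡n)

  n≤a+t : n ≤ a + t
  -- From n + n = a + b and b ≤ n + t, cancelling one `n`.
  n≤a+t = +-cancelʳ-≤ n n (a + t) (≤-trans (≤-reflexive (sym a+b≡n+n))
    (≤-trans (+-monoʳ-≤ a (m≤n+∣m-n∣ b n))
      (≤-reflexive (trans (cong (λ x → a + x) (+-comm n t)) (sym (+-assoc a t n))))))

-- `antidiagonal` starts at a = 0, hence at b = N, so `b` runs downwards.
antidiagonal-sum : ∀ (h : ℕ → Series) N n →
  antidiagonal (λ _ → h) N n ≡ sum (map (λ b → h b n) (downFrom (suc N)))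
antidiagonal-sum h zero    n = sym (+-identityʳ _)
antidiagonal-sum h (suc N) n = cong (λ x → h (suc N) n + x) (antidiagonal-sum h N n)

-- The witness is b = j + n, a natural number because -n ≤ j; for negative j it is a truncated
-- difference that is in fact exact.
centred-surjective : ∀ n j → ℤ.∣ j ∣ ≤ n → ∃[ b ] b < suc (n + n) × j ≡ centred n b
centred-surjective n j ∣j∣≤n = let b , b≤2n , b≡ = shifted j ∣j∣≤n in
  b , s≤s b≤2n , trans (sym (//-rightDividesʳ (+ n) j)) (cong (_- + n) (sym b≡))
  where
  open import Algebra.Properties.AbelianGroup ℤ.+-0-abelianGroup using (//-rightDividesʳ)

  shifted : ∀ j → ℤ.∣ j ∣ ≤ n → ∃[ b ] b ≤ n + n × + b ≡ j ℤ.+ + n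
  shifted (+ k)    k≤n = k + n , +-monoˡ-≤ n k≤n , refl
  shifted -[1+ k ] k<n = n ∸ suc k , ≤-trans (m∸n≤m n (suc k)) (m≤m+n n n) , sym (ℤ.⊖-≥ k<n)

theorem4p16 : (n : ℕ) → (λ j → pod (+ n - j ^ 2)) HasSum (qodd''' n)
theorem4p16 n =
  -- The support is taken inside -n ≤ j ≤ n, which is exactly the range of j in `finite-jacobi n n`.
  map (centred n) (downFrom (suc (n + n))) ,
  Unique.map⁺ (λ eq → ℤ.+-injective (∙-cancelʳ (ℤ.- + n) _ _ eq)) (Unique.downFrom⁺ _) ,
  vanishes , total
  where
  open import Algebra.Properties.AbelianGroup ℤ.+-0-abelianGroup using (∙-cancelʳ)

  vanishes : ∀ j → j ∉ map (centred n) (downFrom (suc (n + n))) → pod (+ n - j ^ 2) ≡ 0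
  vanishes j j∉ with ℤ.∣ j ∣ ≤? n
  ... | yes ∣j∣≤n with b , b< , refl ← centred-surjective n j ∣j∣≤n =
    contradiction (∈-map⁺ (centred n) (∈-downFrom⁺ b<)) j∉
  -- Here n < |j| ≤ j², so the argument of `pod` is negative.
  ... | no ∣j∣≰n = trans (pod-minus-square n j)
    (shift-small _ (≤-trans (≰⇒> ∣j∣≰n) (m≤m*m ℤ.∣ j ∣)))

  total : sum (map (λ j → pod (+ n - j ^ 2)) (map (centred n) (downFrom (suc (n + n))))) ≡ qodd''' n
  total = sym (begin
    qodd''' n
      ≡⟨ qodd'''-oddProduct n ⟩
    oddProduct n (oddProduct n (oddProduct n one)) n
      ≡⟨ oddProduct-cong n (finite-jacobi n n) n ⟩
    oddProduct n (antidiagonal (λ a b → shift (∣-∣² b n) (gauss a b)) (n + n)) n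
      ≡⟨ antidiagonal-oddProduct n _ (n + n) n ⟩
    antidiagonal (λ a b → oddProduct n (shift (∣-∣² b n) (gauss a b))) (n + n) n
      ≡⟨ antidiagonal-cong-at (n + n) n (oddProduct-jacobi-term n) ⟩
    antidiagonal (λ _ b m → pod (+ m - centred n b ^ 2)) (n + n) n
      ≡⟨ antidiagonal-sum (λ b m → pod (+ m - centred n b ^ 2)) (n + n) n ⟩
    sum (map (λ b → pod (+ n - centred n b ^ 2)) (downFrom (suc (n + n))))
      ≡⟨ cong sum (map-∘ (downFrom (suc (n + n)))) ⟩
    sum (map (λ j → pod (+ n - j ^ 2)) (map (centred n) (downFrom (suc (n + n))))) ∎)
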